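{- The longest $(5/2)$-free word over the binary alphabet $\{0,1\}$ whose curling-number transform is $3^+$-free has length $75$. That is, there exists a $(5/2)$-free binary word $x$ of length $75$ with $C(x)$ being $3^+$-free, and there is no such word of length greater than $75$.
   Context: Words are indexed from $0$: a finite word of length $n$ is $x = x[0]x[1]\cdots x[n-1]$, and $x[i..j]$ denotes the factor (contiguous block) $x[i]\cdots x[j]$. A finite word $x$ of length $n \ge 1$ has period $p$, $1\le p\le n$, if $x[i]=x[i+p]$ for all $0\le i<n-p$; its exponent is $n/p$ where $p$ is its least period. A word is $\alpha$-free if it has no nonempty finite factor of exponent at least $\alpha$, and $\alpha^+$-free if it has no nonempty finite factor of exponent strictly greater than $\alpha$. The curling number of a nonempty finite word $u$ is the largest integer $k \ge 1$ such that $u = y z^k$ for some (possibly empty) word $y$ and some nonempty word $z$. For a finite or infinite word $x$, the curling-number transform $C(x)$ is the word over the positive integers, of the same length as $x$, whose $i$-th letter $C(x)[i]$ is the curling number of the prefix $x[0..i]$. -}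

module Defs where

open import Data.Fin.Base using (Fin; toℕ)
open import Data.Fin.Properties using (all?; toℕ<n)
open import Data.Integer.Base using (+_)
open import Data.List.Base
  using (List; []; _∷_; _++_; length; lookup; take; drop; concat; replicate;
         filter; applyUpTo; tabulate)
open import Data.List.Extrema.Nat
  using (min; max; min≤v⁺; v≤max⁺; argmin-all; argmax-all)
open import Data.List.Membership.Propositional using (lose)
open import Data.List.Membership.Propositional.Properties
  using (∈-filter⁺; ∈-applyUpTo⁺)
open import Data.List.NonEmpty.Base as List⁺ using (List⁺; _∷_; toList)
open import Data.List.Properties
  using (length-++; length-++-≤ˡ; length-++-≤ʳ; ≡-dec; ++-identityʳ)
open import Data.List.Relation.Binary.Infix.Heterogeneous using (Infix)
open import Data.List.Relation.Unary.All.Properties using (all-filter)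
open import Data.Nat.Base
  using (ℕ; zero; suc; _+_; _≤_; _<_; NonZero; z≤n; s≤s; >-nonZero)
open import Data.Nat.Properties as ℕₚ
  using (≤-refl; ≤-trans; ≤-reflexive; m≤n+m; +-mono-≤; anyUpTo?; <⇒≱)
open import Data.Product.Base using (∃; ∃₂; _×_; _,_; proj₁)
open import Data.Rational.Base as ℚ using (ℚ; _/_)
open import Data.Sum.Base using (inj₂)
open import Function.Base using (id)
open import Relation.Binary.PropositionalEquality
  using (_≡_; refl; sym; trans; cong)
open import Relation.Binary.TypeClasses using (IsDecEquivalence; _≟_)
open import Relation.Nullary.Decidable using (Dec; no; map′; _×-dec_; _→-dec_)
open import Relation.Nullary.Negation using (¬_; contradiction)

private
  variable
    A : Set

IsPeriod : List A → ℕ → Set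
IsPeriod x p =
  (1 ≤ p × p ≤ length x) ×
  (∀ (i j : Fin (length x)) → toℕ j ≡ toℕ i + p → lookup x i ≡ lookup x j)

module _ {{_ : IsDecEquivalence {A = A} _≡_}} where

  isPeriod? : (x : List A) (p : ℕ) → Dec (IsPeriod x p)
  isPeriod? x p =
    ((1 ℕₚ.≤? p) ×-dec (p ℕₚ.≤? length x)) ×-dec
    all? (λ i → all? (λ j → (toℕ j ℕₚ.≟ toℕ i + p) →-dec (lookup x i ≟ lookup x j)))

  -- The default value, length x, is itself a period.
  leastPeriod : List⁺ A → ℕ
  leastPeriod x =
    min (List⁺.length x)
        (filter (isPeriod? (toList x)) (applyUpTo suc (List⁺.length x)))

  leastPeriod-isPeriod : (x : List⁺ A) → IsPeriod (toList x) (leastPeriod x)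
  leastPeriod-isPeriod x =
    argmin-all id length-isPeriod (all-filter (isPeriod? (toList x)) (applyUpTo suc (List⁺.length x)))
    where
    length-isPeriod : IsPeriod (toList x) (List⁺.length x)
    length-isPeriod = (s≤s z≤n , ≤-refl) , λ i j j≡i+n →
      contradiction (≤-trans (m≤n+m _ (toℕ i)) (≤-reflexive (sym j≡i+n))) (<⇒≱ (toℕ<n j))

  leastPeriod-least : (x : List⁺ A) {p : ℕ} → IsPeriod (toList x) p → leastPeriod x ≤ p
  leastPeriod-least x {suc p} per@((_ , p≤n) , _) =
    min≤v⁺ (List⁺.length x) _ (inj₂ (lose (∈-filter⁺ (isPeriod? (toList x)) (∈-applyUpTo⁺ suc p≤n) per) ≤-refl))

  leastPeriod-nonZero : (x : List⁺ A) → NonZero (leastPeriod x)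
  leastPeriod-nonZero x = >-nonZero (proj₁ (proj₁ (leastPeriod-isPeriod x)))

  exponent : List⁺ A → ℚ
  exponent x = (+ List⁺.length x / leastPeriod x) {{leastPeriod-nonZero x}}

  Free : ℚ → List A → Set
  Free α x = ∀ (w : List⁺ A) → Infix _≡_ (toList w) x → ¬ (α ℚ.≤ exponent w)

  Free⁺ : ℚ → List A → Set
  Free⁺ α x = ∀ (w : List⁺ A) → Infix _≡_ (toList w) x → ¬ (α ℚ.< exponent w)

infixr 8 _^_

_^_ : List⁺ A → ℕ → List A
z ^ k = concat (replicate k (toList z))

EndsInPower : List A → ℕ → Set
EndsInPower u k = 1 ≤ k × ∃₂ λ y z → u ≡ y ++ z ^ k

private
  take-length : (xs ys : List A) → take (length xs) (xs ++ ys) ≡ xs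
  take-length []       ys = refl
  take-length (x ∷ xs) ys = cong (x ∷_) (take-length xs ys)

  drop-length : (xs ys : List A) → drop (length xs) (xs ++ ys) ≡ ys
  drop-length []       ys = refl
  drop-length (x ∷ xs) ys = drop-length xs ys

  k≤length-^ : (z : List⁺ A) (k : ℕ) → k ≤ length (z ^ k)
  k≤length-^ z zero    = z≤n
  k≤length-^ z (suc k) = ≤-trans (+-mono-≤ (s≤s z≤n) (k≤length-^ z k))
    (≤-reflexive (sym (length-++ (toList z))))

  power-bound : {u : List A} {k : ℕ} → EndsInPower u k → k ≤ length u
  power-bound {k = k} (_ , y , z , refl) = ≤-trans (k≤length-^ z k) (length-++-≤ʳ (z ^ k) {y})

module _ {{_ : IsDecEquivalence {A = A} _≡_}} where

  private
    -- Reads off y and z as blocks of u of the given lengths.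
    SplitAt : List A → ℕ → ℕ → ℕ → Set
    SplitAt u k i j = ∃ λ z → take j (drop i u) ≡ toList z × u ≡ take i u ++ z ^ k

    splitAt? : ∀ u k i j → Dec (SplitAt u k i j)
    splitAt? u k i j with take j (drop i u)
    ... | []     = no λ { (_ , () , _) }
    ... | a ∷ as = map′ (λ eq → a ∷ as , refl , eq) (λ { (_ , refl , eq) → eq })
                        (≡-dec _≟_ u (take i u ++ (a ∷ as) ^ k))

  endsInPower? : (u : List A) (k : ℕ) → Dec (EndsInPower u k)
  endsInPower? u zero        = no λ { (() , _) }
  endsInPower? u k@(suc k-1) = map′ to from
    (anyUpTo? (λ i → anyUpTo? (splitAt? u k i) (suc (length u))) (suc (length u)))
    where
    Split : Set
    Split = ∃ λ i → i < suc (length u) × ∃ λ j → j < suc (length u) × SplitAt u k i j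

    to : Split → EndsInPower u k
    to (i , _ , _ , _ , z , _ , eq) = s≤s z≤n , take i u , z , eq

    from : EndsInPower u k → Split
    from (_ , y , z , refl) =
      length y , s≤s (length-++-≤ˡ y) ,
      List⁺.length z ,
      s≤s (≤-trans (length-++-≤ˡ (toList z)) (length-++-≤ʳ (z ^ k) {y})) ,
      z ,
      trans (cong (take (List⁺.length z)) (drop-length y (z ^ k)))
            (take-length (toList z) (z ^ k-1)) ,
      cong (_++ z ^ k) (sym (take-length y (z ^ k)))

  -- EndsInPower u k forces k ≤ length u, so a bounded search suffices.
  -- The default value, 1, is always attained (y empty, z = u).
  curlingNumber : List⁺ A → ℕ
  curlingNumber u =
    max 1 (filter (endsInPower? (toList u)) (applyUpTo suc (List⁺.length u)))

  curlingNumber-power : (u : List⁺ A) → EndsInPower (toList u) (curlingNumber u)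
  curlingNumber-power u =
    argmax-all id (≤-refl , [] , u , sym (++-identityʳ (toList u)))
      (all-filter (endsInPower? (toList u)) (applyUpTo suc (List⁺.length u)))

  curlingNumber-largest : (u : List⁺ A) {k : ℕ} → EndsInPower (toList u) k → k ≤ curlingNumber u
  curlingNumber-largest u {suc k} e =
    v≤max⁺ 1 _ (inj₂ (lose
      (∈-filter⁺ (endsInPower? (toList u)) (∈-applyUpTo⁺ suc (power-bound e)) e) ≤-refl))

  prefix : (x : List A) → Fin (length x) → List⁺ A
  prefix (a ∷ x) i = a ∷ take (toℕ i) x

  C : List A → List ℕ
  C x = tabulate (λ i → curlingNumber (prefix x i))

{-# OPTIONS --safe #-}
-- The words with both properties are closed under prefixes, so they form a tree under extension by
-- one letter on the right. A word and the sequence of curling numbers of its prefixes are both kept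
-- reversed: the extensions of a word are then its conses, and a forbidden factor, when it first
-- appears, sits at the head. A (5/2)-free word contains no cube, so its curling numbers are 2 or 1
-- according to whether the prefix ends in a square. The tree has about nine thousand nodes,
-- and evaluating an exhaustive search shows that no branch goes beyond length 75.
module Submission where

open import Defs
open import Data.Bool.Base using (Bool; true; false; if_then_else_; _∧_; _∨_; T)
open import Data.Bool.Properties using (T-∧; T-∨)
open import Data.Fin.Base using (Fin; zero; suc; toℕ; fromℕ<)
open import Data.Fin.Instances using (Fin-≡-isDecEquivalence)
open import Data.Fin.Patterns using (0F; 1F)
open import Data.Fin.Properties using (toℕ<n; toℕ-injective; toℕ-fromℕ<)
open import Data.Integer.Base as ℤ using (+_)
open import Data.Integer.Properties using (drop‿+≤+; pos-*)
open import Data.List.Base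
  using (List; []; _∷_; _++_; _ʳ++_; reverse; length; lookup; take; drop; tabulate; tails)
open import Data.List.NonEmpty.Base as List⁺ using (List⁺; _∷_; toList)
open import Data.List.Properties
  using (++-assoc; ++-identityʳ; length-++; length-reverse; length-take; ++-ʳ++;
         ʳ++-ʳ++; ʳ++-defn; reverse-++; reverse-involutive; tabulate-cong; take++drop≡id;
         ∷-injective)
open import Data.List.Relation.Binary.Infix.Heterogeneous
  using (Infix; View; MkView; toView; _++ⁱ_; _ⁱ++_)
open import Data.List.Relation.Binary.Infix.Heterogeneous.Properties using (fromPointwise)
open import Data.List.Relation.Binary.Pointwise using (Pointwise-≡⇒≡; ≡⇒Pointwise-≡)
open import Data.List.Relation.Unary.All using (All; _∷_; all?)
open import Data.Nat.Base as ℕ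
  using (ℕ; zero; suc; _+_; _*_; _∸_; _≤_; _<_; _>_; NonZero; z≤n; s≤s; z<s)
open import Data.Nat.DivMod
  using (/-monoˡ-≤; m≡m%n+[m/n]*n; m%n<n; m<n*o⇒m/o<n)
open import Data.Nat.Instances using (ℕ-≡-isDecEquivalence)
open import Data.Nat.Properties
  using (≤-refl; ≤-trans; ≤-reflexive; ≤-pred; <⇒≱; <⇒≢; ≰⇒>; n<1+n; n≤1+n; m≤m+n; m≤n+m; m<m+n;
         +-comm; +-suc; +-mono-≤; +-monoˡ-≤; +-monoʳ-≤; +-monoʳ-<; +-cancelˡ-≤; +-cancelˡ-<;
         +-cancelˡ-≡; *-identityˡ; *-identityʳ; *-distribʳ-+; *-monoˡ-≤; *-monoʳ-≤; *-cancelʳ-≤;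
         m+[n∸m]≡n; m≤n⇒m⊓n≡m; suc-injective; module ≤-Reasoning)
open import Data.Nat.Tactic.RingSolver using (solve-∀)
open import Data.Product.Base using (∃; ∃₂; _×_; _,_; proj₁; proj₂)
open import Data.Rational.Base as ℚ using (ℚ; _/_)
open import Data.Rational.Properties as ℚₚ using (toℚᵘ-fromℚᵘ)
open import Data.Rational.Unnormalised.Base as ℚᵘ using (mkℚᵘ)
open import Data.Rational.Unnormalised.Properties as ℚᵘₚ using (drop-*≤*)
open import Data.Sum.Base using (inj₁; inj₂)
open import Data.Unit.Base using (tt)
open import Function.Base using (id; _∘_)
open import Function.Bundles using (module Equivalence)
open import Relation.Binary.PropositionalEquality
  using (_≡_; refl; sym; trans; cong; cong₂; subst; subst₂; module ≡-Reasoning)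
open import Relation.Binary.TypeClasses using (IsDecEquivalence; _≟_)
open import Relation.Nullary.Decidable
  using (Dec; does; _because_; yes; no; ¬?)
open import Relation.Nullary.Negation using (¬_; contradiction)
open import Relation.Nullary.Reflects using (Reflects; ofʸ; ofⁿ)

private
  variable
    A : Set

-- Ratios of natural numbers

-- `_/_` reduces to lowest terms, so the comparison is carried over to unnormalised fractions, whose
-- order is cross-multiplication.
a/b≤m/n⇒an≤mb : ∀ a b m n .{{_ : NonZero b}} .{{_ : NonZero n}} →
  + a / b ℚ.≤ + m / n → a * n ≤ m * b
a/b≤m/n⇒an≤mb a b@(suc b-1) m n@(suc n-1) le =
  drop‿+≤+ (subst₂ ℤ._≤_ (sym (pos-* a n)) (sym (pos-* m b)) (drop-*≤* unnormalised))
  where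
  unnormalised : mkℚᵘ (+ a) b-1 ℚᵘ.≤ mkℚᵘ (+ m) n-1
  unnormalised = ℚᵘₚ.≤-respˡ-≃ (toℚᵘ-fromℚᵘ (mkℚᵘ (+ a) b-1))
    (ℚᵘₚ.≤-respʳ-≃ (toℚᵘ-fromℚᵘ (mkℚᵘ (+ m) n-1)) (ℚₚ.toℚᵘ-mono-≤ le))

an≤mb⇒a/b≤m/n : ∀ a b m n .{{_ : NonZero b}} .{{_ : NonZero n}} →
  a * n ≤ m * b → + a / b ℚ.≤ + m / n
an≤mb⇒a/b≤m/n a b@(suc b-1) m n@(suc n-1) le = ℚₚ.toℚᵘ-cancel-≤
  (ℚᵘₚ.≤-respˡ-≃ (ℚᵘₚ.≃-sym (toℚᵘ-fromℚᵘ (mkℚᵘ (+ a) b-1)))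
    (ℚᵘₚ.≤-respʳ-≃ (ℚᵘₚ.≃-sym (toℚᵘ-fromℚᵘ (mkℚᵘ (+ m) n-1))) (ℚᵘ.*≤* cross)))
  where
  cross : + a ℤ.* + n ℤ.≤ + m ℤ.* + b
  cross = subst₂ ℤ._≤_ (pos-* a n) (pos-* m b) (ℤ.+≤+ le)

a/b<m/n⇒an<mb : ∀ a b m n .{{_ : NonZero b}} .{{_ : NonZero n}} →
  + a / b ℚ.< + m / n → a * n < m * b
a/b<m/n⇒an<mb a b m n lt = ≰⇒> λ le →
  ℚₚ.<-irrefl refl (ℚₚ.<-≤-trans lt (an≤mb⇒a/b≤m/n m n a b le))

an<mb⇒a/b<m/n : ∀ a b m n .{{_ : NonZero b}} .{{_ : NonZero n}} →
  a * n < m * b → + a / b ℚ.< + m / n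
an<mb⇒a/b<m/n a b m n lt = ℚₚ.≰⇒> λ le → <⇒≱ lt (a/b≤m/n⇒an≤mb m n a b le)

-- X is a lower bound on exponents; a word of period p meets it once it extends
-- its first p letters by at least e p more.
record Threshold (X : ℚ → Set) (e : ℕ → ℕ) : Set where
  field
    mono    : ∀ {p q} → p ≤ q → e p ≤ e q
    meets   : ∀ n p .{{_ : NonZero p}} → p + e p ≤ n → X (+ n / p)
    meets⁻¹ : ∀ n p .{{_ : NonZero p}} → X (+ n / p) → p + e p ≤ n

open Threshold

-- `n / p` is at least 5/2 exactly when `n` exceeds `p` by 3p/2 or more; lengths are integers, hence
-- the rounding up.
⌈3p/2⌉ : ℕ → ℕ
⌈3p/2⌉ p = suc (3 * p) ℕ./ 2

-- The exponent has to be strictly above 3, so one letter more than `2 * p` is needed.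
2p+1 : ℕ → ℕ
2p+1 p = suc (2 * p)

5p≡p*2+3p : ∀ p → 5 * p ≡ p * 2 + 3 * p
5p≡p*2+3p = solve-∀

threshold-5/2 : Threshold (+ 5 / 2 ℚ.≤_) ⌈3p/2⌉
threshold-5/2 .mono p≤q = /-monoˡ-≤ 2 (s≤s (*-monoʳ-≤ 3 p≤q))
threshold-5/2 .meets n p le = an≤mb⇒a/b≤m/n 5 2 n p (begin
  5 * p                                    ≡⟨ 5p≡p*2+3p p ⟩
  p * 2 + 3 * p                            ≤⟨ +-monoʳ-≤ (p * 2) 3p≤ ⟩
  p * 2 + ⌈3p/2⌉ p * 2                     ≡⟨ *-distribʳ-+ 2 p (⌈3p/2⌉ p) ⟨
  (p + ⌈3p/2⌉ p) * 2                       ≤⟨ *-monoˡ-≤ 2 le ⟩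
  n * 2                                    ∎)
  where
  open ≤-Reasoning
  3p≤ : 3 * p ≤ ⌈3p/2⌉ p * 2
  3p≤ = ≤-pred (begin
    suc (3 * p)                            ≡⟨ m≡m%n+[m/n]*n (suc (3 * p)) 2 ⟩
    -- The remainder is at most 1, which later cancels against the `suc` on the left.
    suc (3 * p) ℕ.% 2 + ⌈3p/2⌉ p * 2       ≤⟨ +-monoˡ-≤ _ (≤-pred (m%n<n (suc (3 * p)) 2)) ⟩
    suc (⌈3p/2⌉ p * 2)                     ∎)
threshold-5/2 .meets⁻¹ n p le = begin
  p + ⌈3p/2⌉ p   ≤⟨ +-monoʳ-≤ p (≤-pred (m<n*o⇒m/o<n {n = suc (n ∸ p)} small)) ⟩
  p + (n ∸ p)    ≡⟨ m+[n∸m]≡n p≤n ⟩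
  n              ∎
  where
  open ≤-Reasoning
  5p≤2n : 5 * p ≤ n * 2
  5p≤2n = a/b≤m/n⇒an≤mb 5 2 n p le
  p≤n : p ≤ n
  p≤n = *-cancelʳ-≤ p n 2 (≤-trans (m≤m+n (p * 2) (3 * p))
    (≤-trans (≤-reflexive (sym (5p≡p*2+3p p))) 5p≤2n))
  3p≤ : 3 * p ≤ (n ∸ p) * 2
  3p≤ = +-cancelˡ-≤ (p * 2) _ _ (begin
    p * 2 + 3 * p          ≡⟨ 5p≡p*2+3p p ⟨
    5 * p                  ≤⟨ 5p≤2n ⟩
    n * 2                  ≡⟨ cong (_* 2) (m+[n∸m]≡n p≤n) ⟨
    (p + (n ∸ p)) * 2      ≡⟨ *-distribʳ-+ 2 p (n ∸ p) ⟩
    p * 2 + (n ∸ p) * 2    ∎)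
  small : suc (3 * p) < suc (n ∸ p) * 2
  small = s≤s (s≤s 3p≤)

threshold-3⁺ : Threshold (+ 3 / 1 ℚ.<_) 2p+1
threshold-3⁺ .mono p≤q = s≤s (*-monoʳ-≤ 2 p≤q)
threshold-3⁺ .meets n p le = an<mb⇒a/b<m/n 3 1 n p (begin-strict
  3 * p             <⟨ n<1+n _ ⟩
  suc (3 * p)       ≡⟨ +-suc p (2 * p) ⟨
  p + suc (2 * p)   ≤⟨ le ⟩
  n                 ≡⟨ *-identityʳ n ⟨
  n * 1             ∎)
  where open ≤-Reasoning
threshold-3⁺ .meets⁻¹ n p lt = begin
  p + suc (2 * p)   ≡⟨ +-suc p (2 * p) ⟩
  suc (3 * p)       ≤⟨ a/b<m/n⇒an<mb 3 1 n p lt ⟩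
  n * 1             ≡⟨ *-identityʳ n ⟩
  n                 ∎
  where open ≤-Reasoning

-- Periods and borders

++-prefix : ∀ (u x : List A) {v y} → u ++ v ≡ x ++ y → length u ≤ length x →
  ∃ λ t → x ≡ u ++ t
++-prefix []      x       _  _        = x , refl
++-prefix (a ∷ u) (b ∷ x) eq (s≤s le) with ∷-injective eq
... | refl , eq′ with ++-prefix u x eq′ le
...   | t , refl = t , refl

-- The equation for `x` and the comparison through `toℕ` avoid casts between `Fin` types whose
-- bounds are only provably equal.
lookup-++ˡ : ∀ {x} (u : List A) {v} → x ≡ u ++ v → ∀ k i → toℕ k ≡ toℕ i →
  lookup x k ≡ lookup u i
lookup-++ˡ (a ∷ u) refl zero    zero    _  = refl
lookup-++ˡ (a ∷ u) refl (suc k) (suc i) eq = lookup-++ˡ u refl k i (suc-injective eq)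

lookup-++ʳ : ∀ {x} (u : List A) {v} → x ≡ u ++ v → ∀ k i → toℕ k ≡ length u + toℕ i →
  lookup x k ≡ lookup v i
lookup-++ʳ []      {v} refl k       i eq = cong (lookup v) (toℕ-injective eq)
lookup-++ʳ (a ∷ u)     refl (suc k) i eq = lookup-++ʳ u refl k i (suc-injective eq)

lookup-prefix : ∀ (u x : List A) → length u ≤ length x →
  (∀ i k → toℕ k ≡ toℕ i → lookup x k ≡ lookup u i) → ∃ λ t → x ≡ u ++ t
lookup-prefix []      x       _        _  = x , refl
lookup-prefix (a ∷ u) (b ∷ x) (s≤s le) eq with eq zero zero refl
... | refl with lookup-prefix u x le (λ i k k≡i → eq (suc i) (suc k) (cong suc k≡i))
...   | t , refl = t , refl

-- Letter `i` of `v` occurs in `x` both at `i`, since `v` is a prefix, and at `length u + i`, since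
-- `v` follows `u`.
border⇒period : ∀ {x} (u v : List A) {t} → 1 ≤ length u → x ≡ u ++ v → x ≡ v ++ t →
  IsPeriod x (length u)
border⇒period {x = x} u v 1≤u x≡uv x≡vt = (1≤u , ≤-trans (m≤m+n _ _) (≤-reflexive (sym |x|))) , eq
  where
  |x| : length x ≡ length u + length v
  |x| = trans (cong length x≡uv) (length-++ u)
  eq : ∀ i j → toℕ j ≡ toℕ i + length u → lookup x i ≡ lookup x j
  eq i j j≡i+u = trans (lookup-++ˡ v x≡vt i i′ (sym (toℕ-fromℕ< i<v)))
    (sym (lookup-++ʳ u x≡uv j i′
      (trans j≡u+i (cong (λ k → length u + k) (sym (toℕ-fromℕ< i<v))))))
    where
    j≡u+i : toℕ j ≡ length u + toℕ i
    j≡u+i = trans j≡i+u (+-comm (toℕ i) (length u))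
    i<v : toℕ i < length v
    i<v = +-cancelˡ-< (length u) _ _ (subst₂ _<_ j≡u+i |x| (toℕ<n j))
    i′ = fromℕ< i<v

-- Dropping `p` letters leaves `v`; periodicity makes `x` agree with `v` at every position of `v`,
-- so `v` is a prefix as well.
period⇒border : ∀ (x : List A) {p} → IsPeriod x p →
  ∃₂ λ u v → ∃ λ t → length u ≡ p × length t ≡ p × x ≡ u ++ v × x ≡ v ++ t
period⇒border x {p} ((_ , p≤x) , eq) =
  u , v , proj₁ prefixed , |u| , |t| , x≡uv , proj₂ prefixed
  where
  open ≡-Reasoning
  u = take p x
  v = drop p x
  x≡uv : x ≡ u ++ v
  x≡uv = sym (take++drop≡id p x)
  |u| : length u ≡ p
  |u| = trans (length-take p x) (m≤n⇒m⊓n≡m p≤x)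
  |x| : length x ≡ p + length v
  |x| = trans (cong length x≡uv) (trans (length-++ u) (cong (_+ length v) |u|))
  prefixed : ∃ λ t → x ≡ v ++ t
  prefixed = lookup-prefix v x (≤-trans (m≤n+m _ p) (≤-reflexive (sym |x|))) λ i k k≡i →
    let j<x = ≤-trans (+-monoʳ-< p (toℕ<n i)) (≤-reflexive (sym |x|))
        j≡  = toℕ-fromℕ< j<x
    in trans (eq k (fromℕ< j<x) (trans j≡ (trans (+-comm p (toℕ i)) (cong (_+ p) (sym k≡i)))))
             (lookup-++ʳ u x≡uv (fromℕ< j<x) i (trans j≡ (cong (_+ toℕ i) (sym |u|))))
  |t| : length (proj₁ prefixed) ≡ p
  |t| = +-cancelˡ-≡ (length v) _ _ (begin
    length v + length (proj₁ prefixed)    ≡⟨ length-++ v ⟨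
    length (v ++ proj₁ prefixed)          ≡⟨ cong length (proj₂ prefixed) ⟨
    length x                              ≡⟨ |x| ⟩
    p + length v                          ≡⟨ +-comm p _ ⟩
    length v + p                          ∎)

-- Repetitions at the head of a word

data Agree {A : Set} : ℕ → List A → List A → Set where
  done : ∀ {x y} → Agree zero x y
  same : ∀ {n a x y} → Agree n x y → Agree (suc n) (a ∷ x) (a ∷ y)

-- RepeatFrom e r p t, for t the word r without its first p letters, says that r starts
-- with a factor of some period q > p and length at least q + e q.
data RepeatFrom {A : Set} (e : ℕ → ℕ) (r : List A) : ℕ → List A → Set where
  here  : ∀ {p a t} → Agree (e (suc p)) r t → RepeatFrom e r p (a ∷ t)
  there : ∀ {p a t} → RepeatFrom e r (suc p) t → RepeatFrom e r p (a ∷ t)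

Repeats : (ℕ → ℕ) → List A → Set
Repeats e r = RepeatFrom e r 0 r

agree-++ : ∀ {n} (v : List A) {x y} → n ≤ length v → Agree n (v ++ x) (v ++ y)
agree-++ {n = zero}  v       _        = done
agree-++ {n = suc n} (a ∷ v) (s≤s le) = same (agree-++ v le)

agree⇒++ : ∀ {n} {x y : List A} → Agree n x y →
  ∃ λ v → ∃₂ λ s t → length v ≡ n × x ≡ v ++ s × y ≡ v ++ t
agree⇒++ done     = [] , _ , _ , refl , refl , refl
agree⇒++ (same m) with agree⇒++ m
... | v , s , t , refl , refl , refl = _ ∷ v , s , t , refl , refl , refl

agree-≤ : ∀ {m n} {x y : List A} → m ≤ n → Agree n x y → Agree m x y
agree-≤ z≤n      _        = done
agree-≤ (s≤s le) (same m) = same (agree-≤ le m)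

repeats-≤ : ∀ {e f} {r : List A} → (∀ p → f p ≤ e p) → Repeats e r → Repeats f r
repeats-≤ {e = e} {f} {r} f≤e = go
  where
  go : ∀ {p t} → RepeatFrom e r p t → RepeatFrom f r p t
  go (here m)  = here (agree-≤ (f≤e _) m)
  go (there m) = there (go m)

-- Removing `t` from `r` leaves a word that, like `r` itself, begins with `v`; this agreement
-- witnesses the period `length t`.
repeats⁺ : ∀ {e} {r : List A} (t v : List A) {s s′} → 1 ≤ length t → e (length t) ≤ length v →
  r ≡ t ++ v ++ s → r ≡ v ++ s′ → Repeats e r
repeats⁺ {e = e} {r} (a ∷ t) v {s} _ le r≡tvs refl =
  subst (RepeatFrom e r 0) (sym r≡tvs) (go 0 a t (agree-++ v le))
  where
  -- The letters passed and the letters of the period still ahead always add up to the whole period.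
  go : ∀ p a t {q} → Agree (e (p + length (a ∷ t))) r q → RepeatFrom e r p (a ∷ t ++ q)
  go p a []      {q} m = here (subst (λ k → Agree (e k) r q) (+-comm p 1) m)
  go p a (b ∷ t) {q} m = there (go (suc p) b t (subst (λ k → Agree (e k) r q) (+-suc p _) m))

repeats⁻ : ∀ {e} {r : List A} → Repeats e r →
  ∃₂ λ t v → ∃₂ λ s s′ → 1 ≤ length t × length v ≡ e (length t) × r ≡ t ++ v ++ s × r ≡ v ++ s′
repeats⁻ {e = e} {r} rep with go rep
  where
  go : ∀ {p t} → RepeatFrom e r p t →
    ∃₂ λ u q → t ≡ u ++ q × 1 ≤ length u × Agree (e (p + length u)) r q
  go {p} (here {a = a} {t} m) =
    a ∷ [] , t , refl , ≤-refl , subst (λ k → Agree (e k) r t) (+-comm 1 p) m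
  go {p} (there {a = a} m) with go m
  ... | u , q , refl , _ , m′ =
    a ∷ u , q , refl , s≤s z≤n , subst (λ k → Agree (e k) r q) (sym (+-suc p (length u))) m′
... | u , q , r≡uq , 1≤u , m with agree⇒++ m
...   | v , s′ , s , |v| , r≡vs′ , refl = u , v , s , s′ , 1≤u , |v| , r≡uq , r≡vs′

module _ {{_ : IsDecEquivalence {A = A} _≡_}} where

  -- Booleans are computed apart from their correctness proofs to keep evaluation fast.
  agreeᵇ : ℕ → List A → List A → Bool
  agreeᵇ zero    _       _       = true
  agreeᵇ (suc n) []      _       = false
  agreeᵇ (suc n) (a ∷ x) []      = false
  agreeᵇ (suc n) (a ∷ x) (b ∷ y) = does (a ≟ b) ∧ agreeᵇ n x y

  repeatFromᵇ : (ℕ → ℕ) → List A → ℕ → List A → Bool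
  repeatFromᵇ e r p []      = false
  repeatFromᵇ e r p (a ∷ t) = agreeᵇ (e (suc p)) r t ∨ repeatFromᵇ e r (suc p) t

  repeatsᵇ : (ℕ → ℕ) → List A → Bool
  repeatsᵇ e r = repeatFromᵇ e r 0 r

  agree-reflects : ∀ n x y → Reflects (Agree n x y) (agreeᵇ n x y)
  agree-reflects zero    x       y       = ofʸ done
  agree-reflects (suc n) []      y       = ofⁿ λ ()
  agree-reflects (suc n) (a ∷ x) []      = ofⁿ λ ()
  agree-reflects (suc n) (a ∷ x) (b ∷ y) with a ≟ b
  ... | no a≢b = ofⁿ λ { (same _) → a≢b refl }
  ... | yes refl with agreeᵇ n x y | agree-reflects n x y
  ...   | true  | ofʸ m  = ofʸ (same m)
  ...   | false | ofⁿ ¬m = ofⁿ λ { (same m) → ¬m m }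

  repeatFrom-reflects : ∀ e r p t → Reflects (RepeatFrom e r p t) (repeatFromᵇ e r p t)
  repeatFrom-reflects e r p []      = ofⁿ λ ()
  repeatFrom-reflects e r p (a ∷ t)
    with agreeᵇ (e (suc p)) r t | agree-reflects (e (suc p)) r t
  ... | true  | ofʸ m  = ofʸ (here m)
  ... | false | ofⁿ ¬m with repeatFromᵇ e r (suc p) t | repeatFrom-reflects e r (suc p) t
  ...   | true  | ofʸ q  = ofʸ (there q)
  ...   | false | ofⁿ ¬q = ofⁿ λ { (here m) → ¬m m ; (there q) → ¬q q }

  repeats-reflects : ∀ e r → Reflects (Repeats e r) (repeatsᵇ e r)
  repeats-reflects e r = repeatFrom-reflects e r 0 r

  repeatsᵇ⇒repeats : ∀ e r → T (repeatsᵇ e r) → Repeats e r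
  repeatsᵇ⇒repeats e r rep with repeatsᵇ e r | repeats-reflects e r
  ... | true | ofʸ p = p

  repeats? : ∀ e r → Dec (Repeats e r)
  repeats? e r = repeatsᵇ e r because repeats-reflects e r

-- Bounded exponents of all factors

tails-++ : ∀ {P : List A → Set} z {q} → All P (tails (z ++ q)) → P q
tails-++ []      {[]}    (p ∷ _)  = p
tails-++ []      {_ ∷ _} (p ∷ _)  = p
tails-++ (a ∷ z)         (_ ∷ ps) = tails-++ z ps

-- Bounding every period, not only the least, keeps `leastPeriod` and fractions out of the
-- combinatorics.
PeriodsBelow : (ℕ → ℕ) → List A → Set
PeriodsBelow e x = ∀ w {p} → Infix _≡_ w x → IsPeriod w p → length w < p + e p

-- If `r` starts with `u ++ v` and also with `v`, then `v` is a border of `u ++ v`. Reversal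
-- preserves the border, so the word has a factor of period `length u` that attains the excluded
-- length exactly.
periodsBelow⇒¬repeats : ∀ {e} (r : List A) {z} → PeriodsBelow e (r ʳ++ z) → ¬ Repeats e r
periodsBelow⇒¬repeats {e = e} r {z} below rep with repeats⁻ rep
... | u , v , s , s′ , 1≤u , |v| , r≡uvs , r≡vs′
  with ++-prefix v (u ++ v) {s′} {s} (trans (sym r≡vs′) (trans r≡uvs (sym (++-assoc u v s))))
         (≤-trans (m≤n+m _ (length u)) (≤-reflexive (sym (length-++ u))))
... | t , uv≡vt = <⇒≢ (below (reverse (u ++ v)) {length (reverse t)} inf
  (border⇒period (reverse t) (reverse v) (≤-trans 1≤u (≤-reflexive (sym |t|)))
    (trans (cong reverse uv≡vt) (reverse-++ v t)) (reverse-++ u v)))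
  (begin
    length (reverse (u ++ v))                     ≡⟨ length-reverse (u ++ v) ⟩
    length (u ++ v)                               ≡⟨ length-++ u ⟩
    length u + length v                           ≡⟨ cong (λ k → length u + k) |v| ⟩
    length u + e (length u)                       ≡⟨ cong (λ k → k + e k) |t| ⟨
    length (reverse t) + e (length (reverse t))   ∎)
  where
  open ≡-Reasoning
  |t| : length (reverse t) ≡ length u
  |t| = trans (length-reverse t) (+-cancelˡ-≡ (length v) _ _ (begin
    length v + length t   ≡⟨ length-++ v ⟨
    length (v ++ t)       ≡⟨ cong length uv≡vt ⟨
    length (u ++ v)       ≡⟨ length-++ u ⟩
    length u + length v   ≡⟨ +-comm (length u) _ ⟩
    length v + length u   ∎))
  factorisation : r ʳ++ z ≡ reverse s ++ reverse (u ++ v) ++ z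
  factorisation = begin
    r ʳ++ z                            ≡⟨ cong (_ʳ++ z) (trans r≡uvs (sym (++-assoc u v s))) ⟩
    ((u ++ v) ++ s) ʳ++ z              ≡⟨ ++-ʳ++ (u ++ v) ⟩
    s ʳ++ ((u ++ v) ʳ++ z)             ≡⟨ ʳ++-defn s ⟩
    reverse s ++ ((u ++ v) ʳ++ z)      ≡⟨ cong (reverse s ++_) (ʳ++-defn (u ++ v)) ⟩
    reverse s ++ reverse (u ++ v) ++ z ∎
  inf : Infix _≡_ (reverse (u ++ v)) (r ʳ++ z)
  inf = subst (Infix _≡_ _) (sym factorisation)
    (reverse s ++ⁱ (fromPointwise (≡⇒Pointwise-≡ refl) ⁱ++ z))

-- If a factor `w` that is too long is followed by `s`, removing `reverse s` from `r` leaves a tail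
-- with `reverse w`, and so a repetition, at its head.
¬repeats⇒periodsBelow : ∀ {e} (r : List A) → All (¬_ ∘ Repeats e) (tails r) →
  PeriodsBelow e (reverse r)
¬repeats⇒periodsBelow {e = e} r ¬rep w {p} inf per = go (toView inf) refl
  where
  go : ∀ {x} → View _≡_ w x → x ≡ reverse r → length w < p + e p
  go (MkView y pw s) x≡ with Pointwise-≡⇒≡ pw
  ... | refl with period⇒border w per
  ...   | u , v , t , |u| , |t| , w≡uv , w≡vt = ≰⇒> λ long →
    tails-++ (reverse s) (subst (All _ ∘ tails) r≡ ¬rep)
      (repeats⁺ (reverse t) (reverse v)
        (subst (1 ≤_) (sym |t′|) (proj₁ (proj₁ per)))
        (subst (λ k → e k ≤ length (reverse v)) (sym |t′|)
          (+-cancelˡ-≤ p _ _ (≤-trans long (≤-reflexive |w|))))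
        (trans (cong (λ k → reverse k ++ reverse y) w≡vt)
          (trans (cong (_++ reverse y) (reverse-++ v t)) (++-assoc (reverse t) _ _)))
        (trans (cong (λ k → reverse k ++ reverse y) w≡uv)
          (trans (cong (_++ reverse y) (reverse-++ u v)) (++-assoc (reverse v) _ _))))
    where
    open ≡-Reasoning
    |t′| : length (reverse t) ≡ p
    |t′| = trans (length-reverse t) |t|
    |w| : length w ≡ p + length (reverse v)
    |w| = begin
      length w                 ≡⟨ cong length w≡uv ⟩
      length (u ++ v)          ≡⟨ length-++ u ⟩
      length u + length v      ≡⟨ cong₂ _+_ |u| (sym (length-reverse v)) ⟩
      p + length (reverse v)   ∎
    r≡ : r ≡ reverse s ++ reverse w ++ reverse y
    r≡ = begin
      r                                         ≡⟨ reverse-involutive r ⟨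
      reverse (reverse r)                       ≡⟨ cong reverse x≡ ⟨
      reverse (y ++ w ++ s)                     ≡⟨ reverse-++ y _ ⟩
      reverse (w ++ s) ++ reverse y             ≡⟨ cong (_++ reverse y) (reverse-++ w s) ⟩
      (reverse s ++ reverse w) ++ reverse y     ≡⟨ ++-assoc (reverse s) _ _ ⟩
      reverse s ++ reverse w ++ reverse y       ∎

-- Instance arguments are passed explicitly below: with an unsolved instance, comparing two
-- exponents unfolds leastPeriod and the normalisation of fractions, which is very slow.
module _ {{dec : IsDecEquivalence {A = A} _≡_}} {X : ℚ → Set} {e : ℕ → ℕ} (X≈e : Threshold X e) where

  Avoids : List A → Set
  Avoids x = ∀ (w : List⁺ A) → Infix _≡_ (toList w) x → ¬ X (exponent {{dec}} w)

  -- A word long enough for some period `p` is long enough for its least period too, because `e` is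
  -- monotone; the least period determines the exponent.
  avoids⇒periodsBelow : ∀ {x} → Avoids x → PeriodsBelow e x
  avoids⇒periodsBelow av []       _   ((1≤p , p≤0) , _) = contradiction (≤-trans 1≤p p≤0) λ ()
  avoids⇒periodsBelow av (a ∷ as) inf per               = ≰⇒> λ le → av w inf
    (meets X≈e (List⁺.length w) (leastPeriod {{dec}} w) {{leastPeriod-nonZero {{dec}} w}}
      (≤-trans (+-mono-≤ least (mono X≈e least)) le))
    where
    w = a ∷ as
    least = leastPeriod-least {{dec}} w per

  periodsBelow⇒avoids : ∀ {x} → PeriodsBelow e x → Avoids x
  periodsBelow⇒avoids below w inf exceeds =
    <⇒≱ (below (toList w) inf (leastPeriod-isPeriod {{dec}} w))
      (meets⁻¹ X≈e (List⁺.length w) (leastPeriod {{dec}} w) {{leastPeriod-nonZero {{dec}} w}} exceeds)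

-- Curling numbers

-- Reversal brings the last copy of `z` to the head, while `_^_` exposes the first.
^-snoc : ∀ (z : List⁺ A) k → z ^ suc k ≡ z ^ k ++ toList z
^-snoc z zero    = ++-identityʳ (toList z)
^-snoc z (suc k) = trans (cong (toList z ++_) (^-snoc z k)) (sym (++-assoc (toList z) _ _))

length-^ : ∀ (z : List⁺ A) k → length (z ^ k) ≡ k * List⁺.length z
length-^ z zero    = refl
length-^ z (suc k) =
  trans (length-++ (toList z)) (cong (λ n → List⁺.length z + n) (length-^ z k))

-- Splitting off the last copy of `z`, or else the first, gives the two factorisations of a
-- repetition: one period extended by `k` further copies.
power⇒repeats : ∀ {x : List A} {k} → EndsInPower x (suc k) → Repeats (k *_) (reverse x)
power⇒repeats {k = k} (_ , y , z , refl) = repeats⁺ Z (reverse (z ^ k))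
  (≤-trans (s≤s z≤n) (≤-reflexive (sym (length-reverse (toList z)))))
  (≤-reflexive (begin
    k * length Z              ≡⟨ cong (k *_) (length-reverse (toList z)) ⟩
    k * List⁺.length z        ≡⟨ length-^ z k ⟨
    length (z ^ k)            ≡⟨ length-reverse (z ^ k) ⟨
    length (reverse (z ^ k))  ∎))
  (begin
    reverse (y ++ z ^ suc k)                      ≡⟨ reverse-++ y _ ⟩
    reverse (z ^ suc k) ++ reverse y              ≡⟨ cong (λ x → reverse x ++ reverse y) (^-snoc z k) ⟩
    reverse (z ^ k ++ toList z) ++ reverse y      ≡⟨ cong (_++ reverse y) (reverse-++ (z ^ k) _) ⟩
    (Z ++ reverse (z ^ k)) ++ reverse y           ≡⟨ ++-assoc Z _ _ ⟩
    Z ++ reverse (z ^ k) ++ reverse y             ∎)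
  (begin
    reverse (y ++ z ^ suc k)                      ≡⟨ reverse-++ y _ ⟩
    reverse (toList z ++ z ^ k) ++ reverse y      ≡⟨ cong (_++ reverse y) (reverse-++ (toList z) _) ⟩
    (reverse (z ^ k) ++ Z) ++ reverse y           ≡⟨ ++-assoc (reverse (z ^ k)) _ _ ⟩
    reverse (z ^ k) ++ Z ++ reverse y             ∎)
  where
  open ≡-Reasoning
  Z = reverse (toList z)

-- For `e = id` the prefixes `t` and `v` of `r` have equal length, so they coincide and `r` starts
-- with `v ++ v`.
square⇒power : ∀ {r : List A} → Repeats id r → EndsInPower (reverse r) 2
square⇒power {r = r} rep with repeats⁻ rep
... | t , v , s , s′ , 1≤t , |v| , r≡tvs , r≡vs′
  with ++-prefix v t {s′} {v ++ s} (trans (sym r≡vs′) r≡tvs) (≤-reflexive |v|)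
... | [] , refl = s≤s z≤n , reverse s , proj₁ Z , (begin
      reverse r                                          ≡⟨ cong reverse r≡tvs ⟩
      reverse (t ++ v ++ s)
        ≡⟨ cong (λ w → reverse (w ++ v ++ s)) (++-identityʳ v) ⟩
      reverse (v ++ v ++ s)                              ≡⟨ reverse-++ v _ ⟩
      reverse (v ++ s) ++ reverse v                      ≡⟨ cong (_++ reverse v) (reverse-++ v s) ⟩
      (reverse s ++ reverse v) ++ reverse v              ≡⟨ ++-assoc (reverse s) _ _ ⟩
      reverse s ++ reverse v ++ reverse v
        ≡⟨ cong (λ w → reverse s ++ reverse v ++ w) (++-identityʳ (reverse v)) ⟨
      reverse s ++ reverse v ++ reverse v ++ []
        ≡⟨ cong (λ w → reverse s ++ w ++ w ++ []) (proj₂ Z) ⟨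
      reverse s ++ proj₁ Z ^ 2                           ∎)
  where
  open ≡-Reasoning
  nonEmpty : ∀ (x : List A) → 1 ≤ length x → ∃ λ z → toList z ≡ x
  nonEmpty (a ∷ x) _ = a ∷ x , refl
  Z = nonEmpty (reverse v) (subst (1 ≤_) (trans (sym |v|) (sym (length-reverse v))) 1≤t)
... | a ∷ t′ , refl = contradiction |v| (<⇒≢ (≤-trans (m<m+n (length v) z<s)
      (≤-reflexive (sym (length-++ v)))))

module _ {{_ : IsDecEquivalence {A = A} _≡_}} where

  -- The curling number of reverse r, provided that reverse r does not end in a cube.
  curl : List A → ℕ
  curl r = if repeatsᵇ id r then 2 else 1

  -- A power of exponent 3 or more contains a repetition of exponent 5/2 at the end; between 1 and
  -- 2, a final square decides. The variable `k` stands for the curling number so that it can be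
  -- matched on.
  largestPower≡curl : ∀ x k → EndsInPower x k → (EndsInPower x 2 → 2 ≤ k) →
    ¬ Repeats ⌈3p/2⌉ (reverse x) → k ≡ curl (reverse x)
  largestPower≡curl x (suc (suc (suc k))) power _ ¬rep = contradiction
    (repeats-≤ (λ p → ≤-trans (⌈3p/2⌉≤2p p) (*-monoˡ-≤ p {2} {2 + k} (s≤s (s≤s z≤n))))
      (power⇒repeats {k = 2 + k} power))
    ¬rep
    where
    2p*2≡4p : ∀ p → 2 * p * 2 ≡ 4 * p
    2p*2≡4p = solve-∀
    ⌈3p/2⌉≤2p : ∀ p → ⌈3p/2⌉ p ≤ 2 * p
    ⌈3p/2⌉≤2p p = ≤-pred (m<n*o⇒m/o<n {n = suc (2 * p)} (s≤s (s≤s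
      (≤-trans (*-monoˡ-≤ p {3} {4} (n≤1+n 3)) (≤-reflexive (sym (2p*2≡4p p)))))))
  largestPower≡curl x 1 _ largest _
    with repeatsᵇ id (reverse x) | repeats-reflects id (reverse x)
  ... | false | _        = refl
  ... | true  | ofʸ sq   = contradiction
    (largest (subst (λ y → EndsInPower y 2) (reverse-involutive x) (square⇒power sq)))
    λ { (s≤s ()) }
  largestPower≡curl x 2 power _ _
    with repeatsᵇ id (reverse x) | repeats-reflects id (reverse x)
  ... | true  | _        = refl
  ... | false | ofⁿ ¬sq  = contradiction
    (repeats-≤ (λ p → ≤-reflexive (sym (*-identityˡ p))) (power⇒repeats {k = 1} power)) ¬sq

  curlingNumber≡curl : ∀ u → ¬ Repeats ⌈3p/2⌉ (reverse (toList u)) →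
    curlingNumber u ≡ curl (reverse (toList u))
  curlingNumber≡curl u = largestPower≡curl (toList u) (curlingNumber u)
    (curlingNumber-power u) (curlingNumber-largest u)

-- Curling-number transforms

private
  variable
    B : Set

-- `r` accumulates the letters already read, so `g` is applied to reversed prefixes.
scan : (List A → B) → List A → List A → List B
scan g r []      = []
scan g r (a ∷ s) = g (a ∷ r) ∷ scan g (a ∷ r) s

-- The longest word comes first, which is the order in which the search stores curling numbers.
values : (List A → B) → List A → List B
values g []      = []
values g (a ∷ r) = g (a ∷ r) ∷ values g r

tabulate≡scan : ∀ (g : List A → B) r s →
  tabulate {n = length s} (λ i → g (take (suc (toℕ i)) s ʳ++ r)) ≡ scan g r s
tabulate≡scan g r []      = refl
tabulate≡scan g r (a ∷ s) = cong (g (a ∷ r) ∷_) (tabulate≡scan g (a ∷ r) s)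

scan-ʳ++ : ∀ (g : List A → B) r s → scan g [] (r ʳ++ s) ≡ values g r ʳ++ scan g r s
scan-ʳ++ g []      s = refl
scan-ʳ++ g (a ∷ r) s = scan-ʳ++ g r (a ∷ s)

module _ {{_ : IsDecEquivalence {A = A} _≡_}} where

  -- No prefix of `x` ends in a repetition of exponent 5/2, so `curl` gives the curling number of
  -- each.
  C≡scan : ∀ (x : List A) → PeriodsBelow ⌈3p/2⌉ x → C x ≡ scan curl [] x
  C≡scan []        below = refl
  C≡scan x@(_ ∷ _) below = trans (tabulate-cong λ i →
      curlingNumber≡curl (prefix x i) (periodsBelow⇒¬repeats _ (below′ (suc (toℕ i)))))
    (tabulate≡scan curl [] x)
    where
    below′ : ∀ n → PeriodsBelow ⌈3p/2⌉ (reverse (take n x) ʳ++ drop n x)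
    below′ n = subst (PeriodsBelow ⌈3p/2⌉)
      (sym (trans (ʳ++-ʳ++ (take n x)) (take++drop≡id n x))) below

  -- A letter of the transform depends only on the prefix ending there, so a repetition at the head
  -- of `values curl r` is, reversed, a factor of the transform of every extension.
  C-ʳ++ : ∀ (r s : List A) → PeriodsBelow ⌈3p/2⌉ (r ʳ++ s) →
    C (r ʳ++ s) ≡ values curl r ʳ++ scan curl r s
  C-ʳ++ r s below = trans (C≡scan (r ʳ++ s) below) (scan-ʳ++ curl r s)

-- The search

-- With c the reversed curling numbers of the prefixes of reverse r, diesᵇ n r c says that every
-- extension of reverse r by n letters runs into a forbidden repetition.
diesᵇ : ℕ → List (Fin 2) → List ℕ → Bool
stuckᵇ : ℕ → List (Fin 2) → List ℕ → Bool

diesᵇ zero    r c = false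
diesᵇ (suc n) r c = stuckᵇ n (0F ∷ r) (curl (0F ∷ r) ∷ c) ∧ stuckᵇ n (1F ∷ r) (curl (1F ∷ r) ∷ c)

stuckᵇ n r c = repeatsᵇ ⌈3p/2⌉ r ∨ (repeatsᵇ 2p+1 c ∨ diesᵇ n r c)

-- Both tests of the search, passed at every node on the path from the empty word to `x`.
Viable : List (Fin 2) → Set
Viable x = ∀ r s → x ≡ r ʳ++ s →
  ¬ Repeats ⌈3p/2⌉ r × ¬ Repeats 2p+1 (values curl r)

-- The letters of `s` select the branch to follow; `n ≤ length s` ensures that they last as long as
-- the search.
dies⇒¬viable : ∀ n r s → T (diesᵇ n r (values curl r)) → n ≤ length s → ¬ Viable (r ʳ++ s)
stuck⇒¬viable : ∀ n r s → T (stuckᵇ n r (values curl r)) → n ≤ length s → ¬ Viable (r ʳ++ s)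

dies⇒¬viable (suc n) r (0F ∷ s) die (s≤s n≤s) =
  stuck⇒¬viable n (0F ∷ r) s (proj₁ (Equivalence.to T-∧ die)) n≤s
dies⇒¬viable (suc n) r (1F ∷ s) die (s≤s n≤s) =
  stuck⇒¬viable n (1F ∷ r) s (proj₂ (Equivalence.to T-∧ die)) n≤s

stuck⇒¬viable n r s stuck n≤s viable with Equivalence.to (T-∨ {repeatsᵇ ⌈3p/2⌉ r}) stuck
... | inj₁ rep = proj₁ (viable r s refl) (repeatsᵇ⇒repeats _ r rep)
... | inj₂ stuck′ with Equivalence.to (T-∨ {repeatsᵇ 2p+1 (values curl r)}) stuck′
...   | inj₁ rep = proj₂ (viable r s refl) (repeatsᵇ⇒repeats _ (values curl r) rep)
...   | inj₂ die = dies⇒¬viable n r s die n≤s viable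

Good : List (Fin 2) → Set
Good x = PeriodsBelow ⌈3p/2⌉ x × PeriodsBelow 2p+1 (C x)

good⇒viable : ∀ {x} → Good x → Viable x
good⇒viable (below , belowᶜ) r s refl =
  periodsBelow⇒¬repeats r below ,
  periodsBelow⇒¬repeats (values curl r) (subst (PeriodsBelow _) (C-ʳ++ r s below) belowᶜ)

free⇒good : ∀ {x} → Free (+ 5 / 2) x → Free⁺ (+ 3 / 1) (C x) → Good x
free⇒good {x} free free⁺ =
  avoids⇒periodsBelow {{Fin-≡-isDecEquivalence {2}}} threshold-5/2 {x} free ,
  avoids⇒periodsBelow {{ℕ-≡-isDecEquivalence}} threshold-3⁺ {C x} free⁺

good⇒free : ∀ {x} → Good x → Free (+ 5 / 2) x × Free⁺ (+ 3 / 1) (C x)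
good⇒free {x} (below , belowᶜ) =
  periodsBelow⇒avoids {{Fin-≡-isDecEquivalence {2}}} threshold-5/2 {x} below ,
  periodsBelow⇒avoids {{ℕ-≡-isDecEquivalence}} threshold-3⁺ {C x} belowᶜ

¬repeats⇒good : ∀ r → All (¬_ ∘ Repeats ⌈3p/2⌉) (tails r) →
  All (¬_ ∘ Repeats 2p+1) (tails (values curl r)) → Good (reverse r)
¬repeats⇒good r ¬rep ¬repᶜ = below , subst (PeriodsBelow _) (sym (C-ʳ++ r [] below))
  (¬repeats⇒periodsBelow (values curl r) ¬repᶜ)
  where
  below : PeriodsBelow ⌈3p/2⌉ (reverse r)
  below = ¬repeats⇒periodsBelow r ¬rep

-- The longest word and the bound, by evaluation

noRepeats? : {{_ : IsDecEquivalence {A = A} _≡_}} → ∀ e (r : List A) →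
  Dec (All (¬_ ∘ Repeats e) (tails r))
noRepeats? e r = all? (¬? ∘ repeats? e) (tails r)

does⇒ : ∀ {P : Set} (p? : Dec P) → does p? ≡ true → P
does⇒ (yes p) _ = p

-- The checks enter as equations, which evaluation settles by `refl` for a concrete word.
noRepeats⇒∃ : ∀ r {n} → length (reverse r) ≡ n → does (noRepeats? ⌈3p/2⌉ r) ≡ true →
  does (noRepeats? 2p+1 (values curl r)) ≡ true →
  ∃ λ (x : List (Fin 2)) → length x ≡ n × Free (+ 5 / 2) x × Free⁺ (+ 3 / 1) (C x)
noRepeats⇒∃ r |r| r✓ c✓ = reverse r , |r| ,
  good⇒free {reverse r} (¬repeats⇒good r (does⇒ (noRepeats? _ r) r✓) (does⇒ (noRepeats? _ _) c✓))

dies⇒length< : ∀ n → diesᵇ n [] [] ≡ true → ∀ x → Viable x → length x < n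
dies⇒length< n eq x viable = ≰⇒> λ le → dies⇒¬viable n [] x (subst T (sym eq) tt) le viable

viable⇒length<76 : ∀ x → Viable x → length x < 76
-- This `refl` runs the whole search from the empty word; 76 is the first length without a viable
-- word.
viable⇒length<76 = dies⇒length< 76 refl

-- A deepest node of the tree, last letter first.
longestʳ : List (Fin 2)
longestʳ =
  0F ∷ 1F ∷ 0F ∷ 0F ∷ 1F ∷ 0F ∷ 1F ∷ 1F ∷ 0F ∷ 0F ∷ 1F ∷ 1F ∷ 0F ∷ 1F ∷ 0F ∷
  0F ∷ 1F ∷ 0F ∷ 1F ∷ 1F ∷ 0F ∷ 0F ∷ 1F ∷ 0F ∷ 0F ∷ 1F ∷ 1F ∷ 0F ∷ 1F ∷ 1F ∷
  0F ∷ 0F ∷ 1F ∷ 0F ∷ 1F ∷ 1F ∷ 0F ∷ 1F ∷ 0F ∷ 0F ∷ 1F ∷ 1F ∷ 0F ∷ 1F ∷ 1F ∷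
  0F ∷ 0F ∷ 1F ∷ 0F ∷ 0F ∷ 1F ∷ 1F ∷ 0F ∷ 1F ∷ 0F ∷ 0F ∷ 1F ∷ 0F ∷ 1F ∷ 1F ∷
  0F ∷ 0F ∷ 1F ∷ 0F ∷ 0F ∷ 1F ∷ 1F ∷ 0F ∷ 1F ∷ 1F ∷ 0F ∷ 0F ∷ 1F ∷ 1F ∷ 0F ∷ []

theorem6 : (∃ λ (x : List (Fin 2)) →
    length x ≡ 75 × Free (+ 5 / 2) x × Free⁺ (+ 3 / 1) (C x))
    × ¬ (∃ λ (x : List (Fin 2)) →
    length x > 75 × Free (+ 5 / 2) x × Free⁺ (+ 3 / 1) (C x))
theorem6 = noRepeats⇒∃ longestʳ refl refl refl ,
  λ { (x , long , free , free⁺) →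
    <⇒≱ (viable⇒length<76 x (good⇒viable {x} (free⇒good {x} free free⁺))) long }
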